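{- For each $n\in\{19,20\}$, the minimal depth of a sorting network on $n$ channels is at most $11$; that is, there exists a sorting network on $n$ channels with at most $11$ layers.
   Context: Fix $n$ channels, numbered $1,\dots,n$ from top to bottom, each carrying a value from a totally ordered set (e.g. the integers). A comparator $(i,j)$ with $1\le i<j\le n$ acts on a vector $(x_1,\dots,x_n)$ by replacing $x_i$ with $\min\{x_i,x_j\}$ and $x_j$ with $\max\{x_i,x_j\}$, leaving all other entries unchanged. A layer is a set of comparators that can be performed in parallel, i.e. a set of comparators in which each channel is used by at most one comparator. A comparator network on $n$ channels of depth $d$ is a sequence of $d$ layers $L_1,\dots,L_d$; given an input vector, the layers are applied in order, and the resulting vector is the output of the network. A comparator network is a sorting network if for every input vector its output $(y_1,\dots,y_n)$ is sorted, i.e. $y_1\le y_2\le\dots\le y_n$. -}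

module Defs where

open import Level using (Level; suc) renaming (_⊔_ to _⊔ˡ_)
open import Data.Nat.Base using (ℕ)
open import Data.Fin.Base using (Fin; _<_)
open import Data.List.Base as List using (List; []; _∷_; concatMap)
open import Data.List.Relation.Unary.Unique.Propositional using (Unique)
open import Data.Vec.Base as Vec using (Vec; lookup; _[_]≔_)
open import Data.Vec.Relation.Unary.Linked using (Linked)
open import Relation.Binary.Bundles using (TotalOrder)
import Algebra.Construct.NaturalChoice.Min as Min
import Algebra.Construct.NaturalChoice.Max as Max

record Comparator (n : ℕ) : Set where
  constructor comparator
  field
    i   : Fin n
    j   : Fin n
    i<j : i < j

channels : ∀ {n} → Comparator n → List (Fin n)
channels c = Comparator.i c ∷ Comparator.j c ∷ []

-- A set of comparators is listed in some order. The two channels of one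
-- comparator differ, so uniqueness in the concatenation says exactly that no
-- channel is used by two comparators; in particular no comparator is repeated.
record Layer (n : ℕ) : Set where
  constructor layer
  field
    comparators : List (Comparator n)
    parallel    : Unique (concatMap channels comparators)

Network : (n d : ℕ) → Set
Network n d = Vec (Layer n) d

module _ {a ℓ₁ ℓ₂} (O : TotalOrder a ℓ₁ ℓ₂) where
  open TotalOrder O using (Carrier; _≤_)
  open Min O using (_⊓_)
  open Max O using (_⊔_)

  applyComparator : ∀ {n} → Vec Carrier n → Comparator n → Vec Carrier n
  applyComparator xs (comparator i j _) =
    (xs [ i ]≔ (lookup xs i ⊓ lookup xs j)) [ j ]≔ (lookup xs i ⊔ lookup xs j)

  -- The comparators of a layer touch disjoint channels, so applying them one
  -- after the other is the same as applying them simultaneously.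
  applyLayer : ∀ {n} → Vec Carrier n → Layer n → Vec Carrier n
  applyLayer xs L = List.foldl applyComparator xs (Layer.comparators L)

  output : ∀ {n d} → Network n d → Vec Carrier n → Vec Carrier n
  output N xs = Vec.foldl′ applyLayer xs N

  Sorted : ∀ {n} → Vec Carrier n → Set (a ⊔ˡ ℓ₂)
  Sorted = Linked _≤_

-- The levels are parameters because quantifying over them here would put
-- the predicate in Setω.
IsSortingNetwork : (a ℓ₁ ℓ₂ : Level) → ∀ {n d} → Network n d → Set (suc (a ⊔ˡ ℓ₁ ⊔ˡ ℓ₂))
IsSortingNetwork a ℓ₁ ℓ₂ {n} N =
  (O : TotalOrder a ℓ₁ ℓ₂) (xs : Vec (TotalOrder.Carrier O) n) → Sorted O (output O N xs)

{-# OPTIONS --safe #-}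
-- To compare two outputs y and y′ at positions i < j, sort the list of y and all
-- inputs and consider its least element u not yet known to be ≤ y′. Replace every
-- input by a bit that may be true only if the input is ≥ u, and false only if it
-- is ≤ y′. The network sorts these bits, so y ≤ y′ or u ≤ y′; in the second case
-- u is dropped from the list. This zero-one principle needs neither decidability
-- of the order nor a strict threshold separating y′ from y.
--
-- The first three layers of the 20-channel network act separately on two blocks
-- of 8 channels and one block of 4 channels. On bits they leave only
-- 20 · 20 · 6 vectors, on which the other eight layers are evaluated. Feeding the
-- minimum to the top channel and deleting that channel leaves a sorting network
-- on 19 channels.
module Submission where

open import Defs
open import Level using (Level)
open import Data.Nat.Base using (ℕ; _≤_)
open import Data.Product.Base using (Σ-syntax; ∃-syntax; _×_)
open import Data.Sum.Base using (_⊎_)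
open import Relation.Binary.PropositionalEquality.Core using (_≡_)

open import Data.Bool.Base as Bool using (Bool; true; false; _∧_; _∨_)
open import Data.Bool.Properties using (≤-trans; _≤?_; _≟_)
open import Data.Fin.Base as Fin using (Fin; zero; suc; fromℕ<)
open import Data.Fin.Properties using (toℕ-fromℕ<) renaming (_≟_ to _≟ᶠ_)
open import Data.List.Base as List using (List; []; _∷_; concatMap; cartesianProductWith; deduplicate)
open import Data.List.Membership.Propositional using (_∈_)
open import Data.List.Membership.Propositional.Properties using (∈-map⁺; ∈-cartesianProductWith⁺; ∈-deduplicate⁺)
open import Data.List.Relation.Binary.Permutation.Propositional using (_↭_; refl; prep; swap; ↭-refl; ↭-trans)
open import Data.List.Relation.Binary.Permutation.Propositional.Properties using (∈-resp-↭; All-resp-↭)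
open import Data.List.Relation.Unary.All as All using (All; []; _∷_)
open import Data.List.Relation.Unary.AllPairs using (AllPairs; []; _∷_)
open import Data.List.Relation.Unary.Any using (here; there)
open import Data.List.Relation.Unary.Unique.DecPropositional using (unique?)
open import Data.List.Relation.Unary.Unique.Propositional using (Unique)
open import Data.Nat.Base using (_<_; s<s⁻¹; z<s; s<s)
import Data.Nat.Properties as ℕ
open import Data.Product.Base using (_,_)
open import Data.Sum.Base using (inj₁; inj₂)
open import Data.Vec.Base as Vec using (Vec; []; _∷_; lookup; _[_]≔_; toList; _++_)
open import Data.Vec.Membership.Propositional.Properties using (∈-lookup; ∈-toList⁺)
open import Data.Vec.Properties using (≡-dec; []≔-lookup)
open import Data.Vec.Relation.Binary.Pointwise.Inductive as Pointwise using (Pointwise; []; _∷_)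
import Data.Vec.Relation.Unary.All as VecAll
import Data.Vec.Relation.Unary.All.Properties as VecAll
open import Data.Vec.Relation.Unary.Linked using (Linked; []; [-]; _∷_; linked?) renaming (tail to linked-tail)
open import Data.Vec.Relation.Unary.Linked.Properties using (lookup⁺)
open import Function.Base using (_∘_)
open import Relation.Binary.Bundles using (TotalOrder)
open import Relation.Binary.Core using (Rel)
open import Relation.Binary.PropositionalEquality.Core using (refl; sym; trans; cong; subst; subst₂; _≢_)
open import Relation.Nullary.Decidable using (Dec; True; toWitness)
import Algebra.Construct.NaturalChoice.Min as Min
import Algebra.Construct.NaturalChoice.Max as Max

private
  variable
    ℓ ℓ′ r : Level
    A : Set ℓ
    B : Set ℓ′
    m n d d′ e e′ : ℕ

-- Networks acting on bits.

applyᵇ : Vec Bool n → Comparator n → Vec Bool n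
applyᵇ bs (comparator i j _) =
  (bs [ i ]≔ (lookup bs i ∧ lookup bs j)) [ j ]≔ (lookup bs i ∨ lookup bs j)

applyLayerᵇ : Vec Bool n → Layer n → Vec Bool n
applyLayerᵇ bs L = List.foldl applyᵇ bs (Layer.comparators L)

outputᵇ : Network n d → Vec Bool n → Vec Bool n
outputᵇ N bs = Vec.foldl′ applyLayerᵇ bs N

-- A record, so that Agda compares the networks and not their symbolic outputs.
record SortsBits (N : Network n d) : Set where
  field
    output-sorted : ∀ bs → Linked Bool._≤_ (outputᵇ N bs)

open SortsBits

outputᵇ-++ : (M : Network n d) (N : Network n e) (bs : Vec Bool n) →
             outputᵇ (M ++ N) bs ≡ outputᵇ N (outputᵇ M bs)
outputᵇ-++ []      N bs = refl
outputᵇ-++ (L ∷ M) N bs = outputᵇ-++ M N (applyLayerᵇ bs L)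

-- The zero-one principle

[]≔-pointwise : {R : A → B → Set r} {xs : Vec A n} {ys : Vec B n} {x : A} {y : B} →
                Pointwise R xs ys → ∀ i → R x y →
                Pointwise R (xs [ i ]≔ x) (ys [ i ]≔ y)
[]≔-pointwise (_  ∷ ps) zero    q = q ∷ ps
[]≔-pointwise (p  ∷ ps) (suc i) q = p ∷ []≔-pointwise ps i q

linked⁺ : {R : Rel A r} (xs : Vec A n) →
          (∀ {i j} → i Fin.< j → R (lookup xs i) (lookup xs j)) → Linked R xs
linked⁺ []           f = []
linked⁺ (x ∷ [])     f = [-]
linked⁺ (x ∷ y ∷ xs) f = f {zero} {suc zero} z<s ∷ linked⁺ (y ∷ xs) (f ∘ s<s)

module _ {a ℓ₁ ℓ₂ : Level} (O : TotalOrder a ℓ₁ ℓ₂) where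
  open TotalOrder O using (Carrier; total) renaming (_≤_ to _⊑_; refl to ⊑-refl; trans to ⊑-trans)
  open Min O using (_⊓_; x⊓y≤x; x⊓y≤y; ⊓-glb)
  open Max O using (_⊔_; x≤x⊔y; x≤y⊔x; ⊔-lub)

  insert : (x : Carrier) {ys : List Carrier} → AllPairs _⊑_ ys →
           ∃[ zs ] (x ∷ ys ↭ zs) × AllPairs _⊑_ zs
  insert x []                   = x ∷ [] , ↭-refl , [] ∷ []
  insert x {y ∷ ys} (y⊑ys ∷ ps) with total x y
  ... | inj₁ x⊑y = x ∷ y ∷ ys , ↭-refl , (x⊑y ∷ All.map (⊑-trans x⊑y) y⊑ys) ∷ y⊑ys ∷ ps
  ... | inj₂ y⊑x with zs , p , qs ← insert x ps =
    y ∷ zs , ↭-trans (swap x y refl) (prep y p) , All-resp-↭ p (y⊑x ∷ y⊑ys) ∷ qs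

  sort : (xs : List Carrier) → ∃[ ys ] (xs ↭ ys) × AllPairs _⊑_ ys
  sort []       = [] , ↭-refl , []
  sort (x ∷ xs) with ys , p , ps ← sort xs with zs , q , qs ← insert x ps =
    zs , ↭-trans (prep x p) q , qs

  module _ (l u : Carrier) where

    -- A relation instead of a function: where `u ⊑ x ⊑ l` both bits are admissible, so choosing a
    -- bit never requires deciding the order.
    data Threshold (x : Carrier) : Bool → Set ℓ₂ where
      below : x ⊑ l → Threshold x false
      above : u ⊑ x → Threshold x true

    ⊓-threshold : ∀ {x y b c} → Threshold x b → Threshold y c → Threshold (x ⊓ y) (b ∧ c)
    ⊓-threshold (below p) _         = below (⊑-trans (x⊓y≤x _ _) p)
    ⊓-threshold (above p) (below q) = below (⊑-trans (x⊓y≤y _ _) q)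
    ⊓-threshold (above p) (above q) = above (⊓-glb p q)

    ⊔-threshold : ∀ {x y b c} → Threshold x b → Threshold y c → Threshold (x ⊔ y) (b ∨ c)
    ⊔-threshold (above p) _         = above (⊑-trans p (x≤x⊔y _ _))
    ⊔-threshold (below p) (above q) = above (⊑-trans q (x≤y⊔x _ _))
    ⊔-threshold (below p) (below q) = below (⊔-lub p q)

    Thresholds : Vec Carrier n → Vec Bool n → Set _
    Thresholds = Pointwise Threshold

    applyComparator-threshold : {xs : Vec Carrier n} {bs : Vec Bool n} (c : Comparator n) →
      Thresholds xs bs → Thresholds (applyComparator O xs c) (applyᵇ bs c)
    applyComparator-threshold (comparator i j _) ts =
      []≔-pointwise ([]≔-pointwise ts i (⊓-threshold tᵢ tⱼ)) j (⊔-threshold tᵢ tⱼ)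
      where
      tᵢ = Pointwise.lookup ts i
      tⱼ = Pointwise.lookup ts j

    comparators-threshold : {xs : Vec Carrier n} {bs : Vec Bool n} (cs : List (Comparator n)) →
      Thresholds xs bs →
      Thresholds (List.foldl (applyComparator O) xs cs) (List.foldl applyᵇ bs cs)
    comparators-threshold []       ts = ts
    comparators-threshold (c ∷ cs) ts = comparators-threshold cs (applyComparator-threshold c ts)

    output-threshold : {xs : Vec Carrier n} {bs : Vec Bool n} (N : Network n d) →
      Thresholds xs bs → Thresholds (output O N xs) (outputᵇ N bs)
    output-threshold []      ts = ts
    output-threshold (L ∷ N) ts = output-threshold N (comparators-threshold (Layer.comparators L) ts)

    -- Sorted bits exclude `true` before `false`: either the first bit is `false`, which puts `x`
    -- below `l`, or the second is `true`, which puts `y` above `u`.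
    ≤-threshold : ∀ {x y b c} → b Bool.≤ c → Threshold x b → Threshold y c → x ⊑ l ⊎ u ⊑ y
    ≤-threshold _        (below p) _         = inj₁ p
    ≤-threshold Bool.b≤b (above _) (above q) = inj₂ q

  module _ (N : Network n d) (sorts : SortsBits N) (xs : Vec Carrier n) {i j : Fin n} (i<j : i Fin.< j) where
    private
      y y′ : Carrier
      y  = lookup (output O N xs) i
      y′ = lookup (output O N xs) j

    -- The invariant of the descent: `us` holds the candidates not yet known to be below `y′`.
    ≤y′-or-∈ : List Carrier → Carrier → Set _
    ≤y′-or-∈ us x = x ⊑ y′ ⊎ x ∈ us

    -- Here `l` is `y′` and `u` is the least candidate. An entry known to be below `y′` gets
    -- `false`; any other is a candidate, hence above `u`, and gets `true`.
    thresholds : ∀ {u us} → All (u ⊑_) us → {zs : Vec Carrier m} →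
      VecAll.All (≤y′-or-∈ (u ∷ us)) zs → ∃[ bs ] Thresholds y′ u zs bs
    thresholds u⊑us VecAll.[] = [] , []
    thresholds u⊑us (p VecAll.∷ ps) with bs , ts ← thresholds u⊑us ps | p
    ... | inj₁ z⊑y′         = false ∷ bs , below z⊑y′ ∷ ts
    ... | inj₂ (here refl)  = true ∷ bs , above ⊑-refl ∷ ts
    ... | inj₂ (there z∈us) = true ∷ bs , above (All.lookup u⊑us z∈us) ∷ ts

    drop-least : ∀ {u us z} → u ⊑ y′ → ≤y′-or-∈ (u ∷ us) z → ≤y′-or-∈ us z
    drop-least u⊑y′ (inj₁ z⊑y′)         = inj₁ z⊑y′
    drop-least u⊑y′ (inj₂ (here refl))  = inj₁ u⊑y′
    drop-least u⊑y′ (inj₂ (there z∈us)) = inj₂ z∈us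

    -- Induction on the candidates. The output bits at `i` and `j` either settle the claim or give
    -- `u ⊑ y′`, and then `u` is discarded. Once no candidate is left, the invariant for `y` itself
    -- is the claim.
    descend : ∀ {us} → AllPairs _⊑_ us → VecAll.All (≤y′-or-∈ us) xs → ≤y′-or-∈ us y → y ⊑ y′
    descend []          ps (inj₁ y⊑y′) = y⊑y′
    descend (u⊑us ∷ us) ps q with bs , ts ← thresholds u⊑us ps
      with ts′ ← output-threshold _ _ N ts
      with ≤-threshold _ _ (lookup⁺ ≤-trans (output-sorted sorts bs) i<j) (Pointwise.lookup ts′ i) (Pointwise.lookup ts′ j)
    ... | inj₁ y⊑y′ = y⊑y′
    ... | inj₂ u⊑y′ = descend us (VecAll.map (drop-least u⊑y′) ps) (drop-least u⊑y′ q)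

    output-monotone : y ⊑ y′
    -- Listing `y` along with the inputs gives its invariant at once, without a proof that outputs
    -- are among the inputs.
    output-monotone with us , p , sorted ← sort (y ∷ toList xs) =
      descend sorted
        (VecAll.lookup⁻ λ k → inj₂ (∈-resp-↭ p (there (∈-toList⁺ (∈-lookup k xs)))))
        (inj₂ (∈-resp-↭ p (here refl)))

zero-one-principle : ∀ {a ℓ₁ ℓ₂} (N : Network n d) → SortsBits N → IsSortingNetwork a ℓ₁ ℓ₂ N
zero-one-principle N sorts O xs = linked⁺ _ (output-monotone O N sorts xs)

-- Deleting the top channel

-- Since `i < j`, a comparator can meet the top channel only through its `i`.
deleteTop : List (Comparator (ℕ.suc n)) → List (Comparator n)
deleteTop []                                     = []
deleteTop (comparator zero    _       _   ∷ cs) = deleteTop cs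
deleteTop (comparator (suc i) (suc j) i<j ∷ cs) = comparator i j (s<s⁻¹ i<j) ∷ deleteTop cs

deleteTop-∉ : ∀ {k : Fin n} (cs : List (Comparator (ℕ.suc n))) →
              All (suc k ≢_) (concatMap channels cs) → All (k ≢_) (concatMap channels (deleteTop cs))
deleteTop-∉ []                                    []           = []
deleteTop-∉ (comparator zero    _       _ ∷ cs) (_ ∷ _ ∷ ps) = deleteTop-∉ cs ps
deleteTop-∉ (comparator (suc i) (suc j) _ ∷ cs) (p ∷ q ∷ ps) =
  (p ∘ cong suc) ∷ (q ∘ cong suc) ∷ deleteTop-∉ cs ps

deleteTop-unique : (cs : List (Comparator (ℕ.suc n))) →
                   Unique (concatMap channels cs) → Unique (concatMap channels (deleteTop cs))
deleteTop-unique []                                    []           = []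
deleteTop-unique (comparator zero    _       _ ∷ cs) (_ ∷ _ ∷ us) = deleteTop-unique cs us
deleteTop-unique (comparator (suc i) (suc j) _ ∷ cs) ((p ∷ ps) ∷ qs ∷ us) =
  ((p ∘ cong suc) ∷ deleteTop-∉ cs ps) ∷ deleteTop-∉ cs qs ∷ deleteTop-unique cs us

deleteTopLayer : Layer (ℕ.suc n) → Layer n
deleteTopLayer (layer cs unique) = layer (deleteTop cs) (deleteTop-unique cs unique)

-- With the least bit on top, a comparator there computes `false ∧ b = false` and `false ∨ b = b`,
-- so omitting it changes nothing.
deleteTop-foldl : (cs : List (Comparator (ℕ.suc n))) (bs : Vec Bool n) →
  List.foldl applyᵇ (false ∷ bs) cs ≡ false ∷ List.foldl applyᵇ bs (deleteTop cs)
deleteTop-foldl []                                    bs = refl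
deleteTop-foldl (comparator zero    (suc j) _ ∷ cs) bs
  rewrite []≔-lookup bs j = deleteTop-foldl cs bs
deleteTop-foldl (comparator (suc i) (suc j) _ ∷ cs) bs = deleteTop-foldl cs _

deleteTop-output : (N : Network (ℕ.suc n) d) (bs : Vec Bool n) →
  outputᵇ N (false ∷ bs) ≡ false ∷ outputᵇ (Vec.map deleteTopLayer N) bs
deleteTop-output []      bs = refl
deleteTop-output (L ∷ N) bs
  rewrite deleteTop-foldl (Layer.comparators L) bs = deleteTop-output N _

-- The deletion is carried out on bits, where `false` is a minimum to feed in; an arbitrary total
-- order may have none.
deleteTop-sortsBits : (N : Network (ℕ.suc n) d) → SortsBits N → SortsBits (Vec.map deleteTopLayer N)
deleteTop-sortsBits N sorts .output-sorted bs =
  linked-tail (subst (Linked Bool._≤_) (deleteTop-output N bs) (output-sorted sorts (false ∷ bs)))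

-- The network on 20 channels

infix 6 _⇀_

_⇀_ : (i j : ℕ) {i<j : True (i ℕ.<? j)} {j<n : True (j ℕ.<? n)} → Comparator n
_⇀_ i j {i<j} {j<n} = comparator (fromℕ< i<n) (fromℕ< (toWitness j<n))
  (subst₂ _<_ (sym (toℕ-fromℕ< i<n)) (sym (toℕ-fromℕ< (toWitness j<n))) (toWitness i<j))
  where i<n = ℕ.<-trans (toWitness i<j) (toWitness j<n)

⟨_⟩ : (cs : List (Comparator n)) {distinct : True (unique? _≟ᶠ_ (concatMap channels cs))} → Layer n
⟨ cs ⟩ {distinct} = layer cs (toWitness distinct)

-- The blocks are channels 0-3 with 12-15, 4-7 with 16-19, and 8-11. Every layer here and in
-- `second` is invariant under the reflection sending channel `k` to `19 - k`.
first : Network 20 3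
first =
  ⟨ 0 ⇀ 12 ∷ 1 ⇀ 13 ∷ 2 ⇀ 14 ∷ 3 ⇀ 15 ∷ 4 ⇀ 16 ∷ 5 ⇀ 17 ∷ 6 ⇀ 18 ∷ 7 ⇀ 19 ∷ 8 ⇀ 10 ∷ 9 ⇀ 11 ∷ [] ⟩ ∷
  ⟨ 0 ⇀ 2 ∷ 1 ⇀ 3 ∷ 4 ⇀ 6 ∷ 5 ⇀ 7 ∷ 8 ⇀ 9 ∷ 10 ⇀ 11 ∷ 12 ⇀ 14 ∷ 13 ⇀ 15 ∷ 16 ⇀ 18 ∷ 17 ⇀ 19 ∷ [] ⟩ ∷
  ⟨ 0 ⇀ 1 ∷ 2 ⇀ 3 ∷ 4 ⇀ 5 ∷ 6 ⇀ 7 ∷ 12 ⇀ 13 ∷ 14 ⇀ 15 ∷ 16 ⇀ 17 ∷ 18 ⇀ 19 ∷ [] ⟩ ∷ []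

second : Network 20 8
second =
  ⟨ 0 ⇀ 4 ∷ 1 ⇀ 12 ∷ 2 ⇀ 16 ∷ 3 ⇀ 17 ∷ 5 ⇀ 8 ∷ 6 ⇀ 9 ∷ 7 ⇀ 18 ∷ 10 ⇀ 13 ∷ 11 ⇀ 14 ∷ 15 ⇀ 19 ∷ [] ⟩ ∷
  ⟨ 1 ⇀ 6 ∷ 3 ⇀ 10 ∷ 4 ⇀ 5 ∷ 7 ⇀ 11 ∷ 8 ⇀ 12 ∷ 9 ⇀ 16 ∷ 13 ⇀ 18 ∷ 14 ⇀ 15 ∷ [] ⟩ ∷
  ⟨ 0 ⇀ 4 ∷ 2 ⇀ 8 ∷ 3 ⇀ 9 ∷ 6 ⇀ 7 ∷ 10 ⇀ 16 ∷ 11 ⇀ 17 ∷ 12 ⇀ 13 ∷ 15 ⇀ 19 ∷ [] ⟩ ∷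
  ⟨ 1 ⇀ 4 ∷ 3 ⇀ 6 ∷ 5 ⇀ 8 ∷ 7 ⇀ 10 ∷ 9 ⇀ 12 ∷ 11 ⇀ 14 ∷ 13 ⇀ 16 ∷ 15 ⇀ 18 ∷ [] ⟩ ∷
  ⟨ 2 ⇀ 3 ∷ 4 ⇀ 5 ∷ 6 ⇀ 8 ∷ 7 ⇀ 9 ∷ 10 ⇀ 12 ∷ 11 ⇀ 13 ∷ 14 ⇀ 15 ∷ 16 ⇀ 17 ∷ [] ⟩ ∷
  ⟨ 2 ⇀ 4 ∷ 3 ⇀ 6 ∷ 5 ⇀ 7 ∷ 8 ⇀ 10 ∷ 9 ⇀ 11 ∷ 12 ⇀ 14 ∷ 13 ⇀ 16 ∷ 15 ⇀ 17 ∷ [] ⟩ ∷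
  ⟨ 1 ⇀ 2 ∷ 3 ⇀ 5 ∷ 6 ⇀ 7 ∷ 8 ⇀ 9 ∷ 10 ⇀ 11 ∷ 12 ⇀ 13 ∷ 14 ⇀ 16 ∷ 17 ⇀ 18 ∷ [] ⟩ ∷
  ⟨ 3 ⇀ 4 ∷ 5 ⇀ 6 ∷ 7 ⇀ 8 ∷ 9 ⇀ 10 ∷ 11 ⇀ 12 ∷ 13 ⇀ 14 ∷ 15 ⇀ 16 ∷ [] ⟩ ∷ []

-- The channels compared differ in one binary digit: the highest, then the middle, then the lowest.
-- On bits the outputs are exactly the monotone functions on the Boolean cube; there are 20, a
-- Dedekind number. Likewise `square` has 6.
cube : Network 8 3
cube =
  ⟨ 0 ⇀ 4 ∷ 1 ⇀ 5 ∷ 2 ⇀ 6 ∷ 3 ⇀ 7 ∷ [] ⟩ ∷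
  ⟨ 0 ⇀ 2 ∷ 1 ⇀ 3 ∷ 4 ⇀ 6 ∷ 5 ⇀ 7 ∷ [] ⟩ ∷
  ⟨ 0 ⇀ 1 ∷ 2 ⇀ 3 ∷ 4 ⇀ 5 ∷ 6 ⇀ 7 ∷ [] ⟩ ∷ []

square : Network 4 2
square =
  ⟨ 0 ⇀ 2 ∷ 1 ⇀ 3 ∷ [] ⟩ ∷
  ⟨ 0 ⇀ 1 ∷ 2 ⇀ 3 ∷ [] ⟩ ∷ []

-- Exhaustive check over the block outputs.

interleave : Vec A 8 → Vec A 8 → Vec A 4 → Vec A 20
interleave xs ys zs =
  Vec.take 4 xs ++ Vec.take 4 ys ++ zs ++ Vec.drop 4 xs ++ Vec.drop 4 ys

-- For twenty variable bits both sides normalise to the same terms in `∧` and `∨`, because `first`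
-- acts as `cube` on the blocks of 8 and as `square` on the block of 4.
first-splits : ∀ bs → ∃[ xs ] ∃[ ys ] ∃[ zs ]
  outputᵇ first bs ≡ interleave (outputᵇ cube xs) (outputᵇ cube ys) (outputᵇ square zs)
first-splits (x₀ ∷ x₁ ∷ x₂ ∷ x₃ ∷ y₀ ∷ y₁ ∷ y₂ ∷ y₃ ∷ z₀ ∷ z₁ ∷ z₂ ∷ z₃ ∷
              x₄ ∷ x₅ ∷ x₆ ∷ x₇ ∷ y₄ ∷ y₅ ∷ y₆ ∷ y₇ ∷ []) =
  x₀ ∷ x₁ ∷ x₂ ∷ x₃ ∷ x₄ ∷ x₅ ∷ x₆ ∷ x₇ ∷ [] ,
  y₀ ∷ y₁ ∷ y₂ ∷ y₃ ∷ y₄ ∷ y₅ ∷ y₆ ∷ y₇ ∷ [] ,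
  z₀ ∷ z₁ ∷ z₂ ∷ z₃ ∷ [] , refl

bits : List Bool
bits = false ∷ true ∷ []

bitVectors : ∀ n → List (Vec Bool n)
bitVectors ℕ.zero    = [] ∷ []
bitVectors (ℕ.suc n) = cartesianProductWith _∷_ bits (bitVectors n)

∈-bits : (b : Bool) → b ∈ bits
∈-bits false = here refl
∈-bits true  = there (here refl)

∈-bitVectors : (bs : Vec Bool n) → bs ∈ bitVectors n
∈-bitVectors []       = here refl
∈-bitVectors (b ∷ bs) = ∈-cartesianProductWith⁺ _∷_ {xs = bits} (∈-bits b) (∈-bitVectors bs)

-- Removing duplicates cuts the triples to be tested from 256 · 256 · 16 to 20 · 20 · 6.
outputs : Network n d → List (Vec Bool n)
outputs N = deduplicate (≡-dec _≟_) (List.map (outputᵇ N) (bitVectors _))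

∈-outputs : (N : Network n d) (bs : Vec Bool n) → outputᵇ N bs ∈ outputs N
∈-outputs N bs = ∈-deduplicate⁺ (≡-dec _≟_) (∈-map⁺ (outputᵇ N) (∈-bitVectors bs))

SortsBlocks : Network 20 d → List (Vec Bool 8) → List (Vec Bool 8) → List (Vec Bool 4) → Set
SortsBlocks N xss yss zss = All (λ xs → All (λ ys → All (λ zs →
  Linked Bool._≤_ (outputᵇ N (interleave xs ys zs))) zss) yss) xss

-- N, xss, yss and zss are arguments so that each is evaluated only once.
sortsBlocks? : (N : Network 20 d) → ∀ xss yss zss → Dec (SortsBlocks N xss yss zss)
sortsBlocks? N xss yss zss = All.all? (λ xs → All.all? (λ ys → All.all? (λ zs →
  linked? _≤?_ (outputᵇ N (interleave xs ys zs))) zss) yss) xss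

second-sorts : SortsBlocks second (outputs cube) (outputs cube) (outputs square)
-- Type checking runs the decision on all 2400 vectors; its success turns `True` of it into the unit
-- type, which fills `_`.
second-sorts = toWitness {a? = sortsBlocks? second (outputs cube) (outputs cube) (outputs square)} _

-- Each output of `M` is assembled from three listed block outputs, so the test of `N` on all
-- triples covers it. The networks are variables, so no concrete layer is evaluated here.
sortsBits-++ : (C : Network 8 d) (S : Network 4 d′) (M : Network 20 e) (N : Network 20 e′) →
  (∀ bs → ∃[ xs ] ∃[ ys ] ∃[ zs ]
    outputᵇ M bs ≡ interleave (outputᵇ C xs) (outputᵇ C ys) (outputᵇ S zs)) →
  SortsBlocks N (outputs C) (outputs C) (outputs S) → SortsBits (M ++ N)
sortsBits-++ C S M N splits sorts .output-sorted bs =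
  let xs , ys , zs , eq = splits bs in
  subst (Linked Bool._≤_) (sym (trans (outputᵇ-++ M N bs) (cong (outputᵇ N) eq)))
    (All.lookup (All.lookup (All.lookup sorts (∈-outputs C xs)) (∈-outputs C ys)) (∈-outputs S zs))

network : Network 20 11
network = first ++ second

network-sortsBits : SortsBits network
network-sortsBits = sortsBits-++ cube square first second first-splits second-sorts

mainTheorem3 : (a ℓ₁ ℓ₂ : Level) (n : ℕ) → n ≡ 19 ⊎ n ≡ 20 →
    ∃[ d ] d ≤ 11 × (Σ[ N ∈ Network n d ] IsSortingNetwork a ℓ₁ ℓ₂ N)
mainTheorem3 a ℓ₁ ℓ₂ n (inj₁ refl) =
  11 , ℕ.≤-refl , Vec.map deleteTopLayer network ,
  zero-one-principle _ (deleteTop-sortsBits network network-sortsBits)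
mainTheorem3 a ℓ₁ ℓ₂ n (inj₂ refl) =
  11 , ℕ.≤-refl , network , zero-one-principle network network-sortsBits
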